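{- For every connected graph $G$, $\gamma_{rdR}(G)\ge \gamma(G)+\gamma_r(G)$. Moreover, equality holds if and only if $G$ is a star $K_{1,m}$ for some $m\ge 1$, or $\gamma_{r2}(G)=\gamma_r(G)=\gamma(G)$.
   Context: All graphs are finite and simple. An RDRD function of $G$ is a function $f:V(G)\to\{0,1,2,3\}$ such that every vertex with value $0$ has at least two neighbors with value $2$ or at least one neighbor with value $3$, every vertex with value $1$ has a neighbor with value $2$ or $3$, and the subgraph induced by the vertices with value $0$ has no isolated vertices; $\gamma_{rdR}(G)$ is the minimum of $\sum_v f(v)$ over RDRD functions. $\gamma(G)$ is the domination number. A restrained dominating set is a set $S\subseteq V(G)$ such that every vertex of $V(G)\setminus S$ has a neighbor in $S$ and a neighbor in $V(G)\setminus S$; $\gamma_r(G)$ is its minimum cardinality. A restrained $2$-dominating set is a set $S$ such that every vertex of $V(G)\setminus S$ has at least two neighbors in $S$ and $G[V(G)\setminus S]$ has no isolated vertices; $\gamma_{r2}(G)$ is its minimum cardinality. -}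

module Defs where

open import Data.Bool.Base using (T; Bool; true; false)
open import Data.Fin.Base using (Fin; zero; suc; toℕ)
open import Data.Fin.Patterns using (0F; 1F; 2F; 3F)
open import Data.Fin.Properties using (any?; all?; _≟_)
open import Data.Fin.Subset using (Subset; _∈_; _∉_; ∣_∣; ⊤)
open import Data.Fin.Subset.Properties using (_∈?_; anySubset?; ∈⊤)
open import Data.Nat.Base using (ℕ; zero; suc; _+_; _≤_; _≥_; z≤n; s≤s; NonZero)
import Data.Nat.Properties as ℕ
open import Data.Product.Base using (∃; ∃₂; ∃-syntax; _×_; _,_; proj₁; proj₂)
open import Data.Sum.Base using (_⊎_)
open import Data.Vec.Base using (Vec; []; _∷_; lookup; sum; map; replicate)
open import Data.Vec.Properties using (lookup-replicate)
open import Function.Base using (_∘_)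
open import Function.Bundles using (_⇔_; _↔_; Inverse)
open import Level using (0ℓ)
open import Relation.Binary.Construct.Closure.ReflexiveTransitive using (Star)
open import Relation.Binary.Core using (Rel)
import Relation.Binary.Definitions as B
open import Relation.Binary.PropositionalEquality using (_≡_; _≢_; refl; trans; sym)
open import Relation.Nullary.Decidable using (Dec; yes; no; map′; T?; ¬?; _×-dec_; _⊎-dec_; _→-dec_)
open import Relation.Nullary.Negation using (¬_; contradiction)
open import Relation.Unary using (Pred; Decidable)

record Graph (n : ℕ) : Set₁ where
  field
    Adj        : Rel (Fin n) 0ℓ
    adj?       : B.Decidable Adj
    adj-sym    : B.Symmetric Adj
    adj-irrefl : ∀ v → ¬ Adj v v

open Graph public

-- The reflexive transitive closure of adjacency is the existence of a walk;
-- a connected graph is required to have at least one vertex.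
Connected : ∀ {n} → Graph n → Set
Connected {n} G = NonZero n × (∀ u v → Star (Adj G) u v)

infix 4 _≅_

_≅_ : ∀ {m n} → Graph m → Graph n → Set
_≅_ {m} {n} G H =
  ∃ λ (φ : Fin m ↔ Fin n) → ∀ u v → Adj G u v ⇔ Adj H (Inverse.to φ u) (Inverse.to φ v)

-- K_{1,m}: the centre is 0F, the m leaves are the successors.
K₁,_ : ∀ m → Graph (suc m)
K₁, m = record
  { Adj        = λ u v → T (star u v)
  ; adj?       = λ u v → T? (star u v)
  ; adj-sym    = λ {u} {v} → star-sym u v
  ; adj-irrefl = star-irrefl
  }
  where
  star : Fin (suc m) → Fin (suc m) → Bool
  star zero    zero    = false
  star zero    (suc _) = true
  star (suc _) zero    = true
  star (suc _) (suc _) = false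

  star-sym : ∀ u v → T (star u v) → T (star v u)
  star-sym zero    (suc _) e = e
  star-sym (suc _) zero    e = e

  star-irrefl : ∀ v → ¬ T (star v v)
  star-irrefl zero    ()
  star-irrefl (suc _) ()

IsStar : ∀ {n} → Graph n → Set
IsStar G = ∃[ m ] m ≥ 1 × G ≅ K₁, m

module _ {n} (G : Graph n) where

  HasNeighbour : Pred (Fin n) 0ℓ → Pred (Fin n) 0ℓ
  HasNeighbour P v = ∃ λ u → Adj G v u × P u

  HasTwoNeighbours : Pred (Fin n) 0ℓ → Pred (Fin n) 0ℓ
  HasTwoNeighbours P v =
    ∃₂ λ u w → u ≢ w × (Adj G v u × P u) × (Adj G v w × P w)

  -- P is the vertex set of the induced subgraph.
  NoIsolatedIn : Pred (Fin n) 0ℓ → Set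
  NoIsolatedIn P = ∀ v → P v → HasNeighbour P v

  hasNeighbour? : ∀ {P} → Decidable P → Decidable (HasNeighbour P)
  hasNeighbour? P? v = any? λ u → adj? G v u ×-dec P? u

  hasTwoNeighbours? : ∀ {P} → Decidable P → Decidable (HasTwoNeighbours P)
  hasTwoNeighbours? P? v = any? λ u → any? λ w →
    ¬? (u ≟ w) ×-dec (adj? G v u ×-dec P? u) ×-dec (adj? G v w ×-dec P? w)

  noIsolatedIn? : ∀ {P} → Decidable P → Dec (NoIsolatedIn P)
  noIsolatedIn? P? = all? λ v → P? v →-dec hasNeighbour? P? v

module _ {n} (G : Graph n) where

  Dominating : Pred (Subset n) 0ℓ
  Dominating S = ∀ v → v ∉ S → HasNeighbour G (_∈ S) v

  RestrainedDominating : Pred (Subset n) 0ℓ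
  RestrainedDominating S =
    ∀ v → v ∉ S → HasNeighbour G (_∈ S) v × HasNeighbour G (_∉ S) v

  Restrained2Dominating : Pred (Subset n) 0ℓ
  Restrained2Dominating S =
    (∀ v → v ∉ S → HasTwoNeighbours G (_∈ S) v) × NoIsolatedIn G (_∉ S)

  RDRD : Pred (Vec (Fin 4) n) 0ℓ
  RDRD f =
    (∀ v → lookup f v ≡ 0F →
       HasTwoNeighbours G (λ u → lookup f u ≡ 2F) v ⊎
       HasNeighbour G (λ u → lookup f u ≡ 3F) v) ×
    (∀ v → lookup f v ≡ 1F →
       HasNeighbour G (λ u → lookup f u ≡ 2F ⊎ lookup f u ≡ 3F) v) ×
    NoIsolatedIn G (λ v → lookup f v ≡ 0F)

weight : ∀ {n} → Vec (Fin 4) n → ℕ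
weight f = sum (map toℕ f)

IsMinimum : {A : Set} → (A → ℕ) → Pred A 0ℓ → ℕ → Set
IsMinimum w P k = (∃ λ x → P x × w x ≡ k) × (∀ x → P x → k ≤ w x)

least : {Q : Pred ℕ 0ℓ} → Decidable Q → ∀ m → Q m → ∃ λ k → Q k × (∀ j → Q j → k ≤ j)
least Q? zero    q = 0 , q , λ _ _ → z≤n
least Q? (suc m) q with Q? 0
... | yes q₀ = 0 , q₀ , λ _ _ → z≤n
... | no ¬q₀ with least (Q? ∘ suc) m q
...   | k , qk , k-least = suc k , qk , λ where
          zero    q₀ → contradiction q₀ ¬q₀
          (suc j) qj → s≤s (k-least j qj)

Searchable : Set → Set₁
Searchable A = {P : Pred A 0ℓ} → Decidable P → Dec (∃ P)

minimum : {A : Set} → Searchable A → (w : A → ℕ) {P : Pred A 0ℓ} →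
          Decidable P → ∃ P → ∃ (IsMinimum w P)
minimum search w P? (x₀ , p₀)
  with least (λ k → search λ x → P? x ×-dec w x ℕ.≟ k) (w x₀) (x₀ , p₀ , refl)
... | k , attained , k-least = k , attained , λ x px → k-least (w x) (x , px , refl)

anyVec? : ∀ {m n} → Searchable (Vec (Fin m) n)
anyVec? {n = zero}  P? = map′ (λ p → [] , p) (λ { ([] , p) → p }) (P? [])
anyVec? {n = suc n} P? =
  map′ (λ (x , xs , p) → x ∷ xs , p) (λ { (x ∷ xs , p) → x , xs , p })
       (any? λ x → anyVec? (P? ∘ (x ∷_)))

module _ {n} (G : Graph n) where

  dominating? : Decidable (Dominating G)
  dominating? S = all? λ v → ¬? (v ∈? S) →-dec hasNeighbour? G (_∈? S) v

  restrainedDominating? : Decidable (RestrainedDominating G)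
  restrainedDominating? S = all? λ v → ¬? (v ∈? S) →-dec
    (hasNeighbour? G (_∈? S) v ×-dec hasNeighbour? G (¬? ∘ (_∈? S)) v)

  restrained2Dominating? : Decidable (Restrained2Dominating G)
  restrained2Dominating? S =
    (all? λ v → ¬? (v ∈? S) →-dec hasTwoNeighbours? G (_∈? S) v) ×-dec
    noIsolatedIn? G (¬? ∘ (_∈? S))

  rdrd? : Decidable (RDRD G)
  rdrd? f =
    (all? λ v → (lookup f v ≟ 0F) →-dec
       (hasTwoNeighbours? G (λ u → lookup f u ≟ 2F) v ⊎-dec
        hasNeighbour? G (λ u → lookup f u ≟ 3F) v)) ×-dec
    (all? λ v → (lookup f v ≟ 1F) →-dec
       hasNeighbour? G (λ u → (lookup f u ≟ 2F) ⊎-dec (lookup f u ≟ 3F)) v) ×-dec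
    noIsolatedIn? G (λ v → lookup f v ≟ 0F)

  constant-2-RDRD : RDRD G (replicate n 2F)
  constant-2-RDRD =
    (λ v e → contradiction (two v e) λ ()) ,
    (λ v e → contradiction (two v e) λ ()) ,
    (λ v e → contradiction (two v e) λ ())
    where
    two : ∀ {k} v → lookup (replicate n 2F) v ≡ k → 2F ≡ k
    two v e = trans (sym (lookup-replicate v 2F)) e

  γ-minimum : ∃ (IsMinimum ∣_∣ (Dominating G))
  γ-minimum = minimum anySubset? ∣_∣ dominating?
    (⊤ , λ v v∉ → contradiction ∈⊤ v∉)

  γr-minimum : ∃ (IsMinimum ∣_∣ (RestrainedDominating G))
  γr-minimum = minimum anySubset? ∣_∣ restrainedDominating?
    (⊤ , λ v v∉ → contradiction ∈⊤ v∉)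

  γr2-minimum : ∃ (IsMinimum ∣_∣ (Restrained2Dominating G))
  γr2-minimum = minimum anySubset? ∣_∣ restrained2Dominating?
    (⊤ , (λ v v∉ → contradiction ∈⊤ v∉) , (λ v v∉ → contradiction ∈⊤ v∉))

  γrdR-minimum : ∃ (IsMinimum weight (RDRD G))
  γrdR-minimum = minimum anyVec? weight rdrd? (replicate n 2F , constant-2-RDRD)

  γ γr γr2 γrdR : ℕ
  γ    = proj₁ γ-minimum
  γr   = proj₁ γr-minimum
  γr2  = proj₁ γr2-minimum
  γrdR = proj₁ γrdR-minimum

{-# OPTIONS --safe #-}
-- Let f be an RDRD function with level sets Vᵢ. Then V₁ ∪ V₂ ∪ V₃ is restrained
-- dominating, V₂ ∪ V₃ is dominating, and the weight of f is
-- ∣V₁ ∪ V₂ ∪ V₃∣ + ∣V₂ ∪ V₃∣ + ∣V₃∣, which gives the inequality.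
--
-- In the case of equality V₃ = ∅ and S = V₁ ∪ V₂ is restrained 2-dominating and
-- minimum among the restrained dominating sets. If V₁ = ∅, this is the second
-- alternative. Otherwise some s ∈ S has a neighbour in S. Such an s has no
-- neighbour outside S, since S - s would be restrained dominating; so S is the
-- whole vertex set by connectedness. Hence no proper subset is restrained
-- dominating, in particular none omits just the two ends of an edge, so every
-- edge has an end of degree one, and G is a star.
module Submission where

open import Defs
open import Data.Bool.Base using (Bool; true; T)
open import Data.Bool.Properties using (¬-not)
open import Data.Fin.Base using (Fin; zero; suc; toℕ)
open import Data.Fin.Patterns using (0F; 1F; 2F; 3F)
import Data.Fin.Permutation as Perm
open import Data.Fin.Properties using (any?; _≟_)
open import Data.Fin.Subset using (Subset; inside; outside; _∈_; _∉_; _⊆_; ∣_∣; ⊤; ⁅_⁆; _-_)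
open import Data.Fin.Subset.Properties
  using (_∈?_; ∈⊤; ∣⊤∣≡n; ∣p∣≤n; p⊆q⇒∣p∣≤∣q∣; x∈⁅x⁆; ∣⁅x⁆∣≡1;
         p─q⊆p; x∈p∧x≢y⇒x∈p-y; x∈p⇒∣p-x∣<∣p∣)
open import Data.Nat.Base using (ℕ; zero; suc; _+_; _≤_; _≥_; _≤ᵇ_; s≤s; z≤n)
import Data.Nat.Properties as ℕ
open import Data.Nat.Tactic.RingSolver using (solve-∀)
open import Data.Product.Base using (∃; _×_; _,_; proj₁; proj₂)
open import Data.Sum.Base using (_⊎_; inj₁; inj₂; [_,_]′)
open import Data.Unit.Base using (tt)
open import Data.Vec.Base using (Vec; []; _∷_; there; lookup; map; zipWith)
open import Data.Vec.Properties using ([]=⇒lookup; lookup⇒[]=; lookup-map; lookup-zipWith)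
open import Function.Base using (_∘_)
open import Function.Bundles using (_⇔_; mk⇔; Equivalence; Inverse)
open import Relation.Binary.Construct.Closure.ReflexiveTransitive using (Star; ε; _◅_)
open import Relation.Binary.PropositionalEquality
open import Relation.Nullary.Decidable using (yes; no; ¬?; _×-dec_; decidable-stable)
open import Relation.Nullary.Negation using (¬_; contradiction)

-- Subsets with one element removed

module _ {n} {p : Subset n} where

  x∉p⇒x∉p-y : ∀ {x} y → x ∉ p → x ∉ p - y
  x∉p⇒x∉p-y y x∉p = x∉p ∘ p─q⊆p p ⁅ y ⁆

  x∉p-y⇒x≡y⊎x∉p : ∀ {x y} → x ∉ p - y → x ≡ y ⊎ x ∉ p
  x∉p-y⇒x≡y⊎x∉p {x} {y} x∉ with x ≟ y
  ... | yes x≡y = inj₁ x≡y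
  ... | no  x≢y = inj₂ λ x∈p → x∉ (x∈p∧x≢y⇒x∈p-y x∈p x≢y)

  x∈p⇒1≤∣p∣ : ∀ {x} → x ∈ p → 1 ≤ ∣ p ∣
  x∈p⇒1≤∣p∣ x∈p = ℕ.≤-trans (s≤s z≤n) (x∈p⇒∣p-x∣<∣p∣ x∈p)

x∉p-x : ∀ {n} (p : Subset n) x → x ∉ p - x
x∉p-x (inside  ∷ p) zero    ()
x∉p-x (outside ∷ p) zero    ()
x∉p-x (_       ∷ p) (suc x) (there x∈) = x∉p-x p x x∈

-- Level sets

level : ∀ {n} → ℕ → Vec (Fin 4) n → Subset n
level k = map λ x → k ≤ᵇ toℕ x

module _ {n} {k : ℕ} {f : Vec (Fin 4) n} {v : Fin n} where

  ∈-level⁺ : k ≤ toℕ (lookup f v) → v ∈ level k f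
  ∈-level⁺ k≤ = lookup⇒[]= v _ (trans (lookup-map v _ f) (T⇒≡ (ℕ.≤⇒≤ᵇ k≤)))
    where
    T⇒≡ : ∀ {b} → T b → b ≡ true
    T⇒≡ {true} _ = refl

  ∈-level⁻ : v ∈ level k f → k ≤ toℕ (lookup f v)
  ∈-level⁻ v∈ = ℕ.≤ᵇ⇒≤ k _ (subst T true≡ tt)
    where
    true≡ : true ≡ (k ≤ᵇ toℕ (lookup f v))
    true≡ = trans (sym ([]=⇒lookup v∈)) (lookup-map v _ f)

-- A vertex of value x belongs to exactly x of the three level sets, so it contributes x to both
-- sides.
weight-level : ∀ {n} (f : Vec (Fin 4) n) →
               weight f ≡ ∣ level 1 f ∣ + ∣ level 2 f ∣ + ∣ level 3 f ∣
weight-level []       = refl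
weight-level (0F ∷ f) = weight-level f
weight-level (1F ∷ f) = cong suc (weight-level f)
weight-level (2F ∷ f) = trans (cong (2 +_) (weight-level f))
  (eq (∣ level 1 f ∣) (∣ level 2 f ∣) (∣ level 3 f ∣))
  where
  eq : ∀ a b c → 2 + (a + b + c) ≡ suc a + suc b + c
  eq = solve-∀
weight-level (3F ∷ f) = trans (cong (3 +_) (weight-level f))
  (eq (∣ level 1 f ∣) (∣ level 2 f ∣) (∣ level 3 f ∣))
  where
  eq : ∀ a b c → 3 + (a + b + c) ≡ suc a + suc b + suc c
  eq = solve-∀

-- The arguments are the membership bits of a vertex in `S` and in `D`. Outside `S` the second bit
-- is ignored, so the value there is 0 whatever `D` is.
rank : Bool → Bool → Fin 4
rank outside _       = 0F
rank inside  outside = 1F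
rank inside  inside  = 2F

-- Only an inequality, because `D ⊆ S` is not assumed: a vertex of `D` outside `S` gets value 0 but
-- is counted in `∣ D ∣`.
weight-rank : ∀ {n} (S D : Subset n) → weight (zipWith rank S D) ≤ ∣ S ∣ + ∣ D ∣
weight-rank []            []            = z≤n
weight-rank (outside ∷ S) (outside ∷ D) = weight-rank S D
weight-rank (outside ∷ S) (inside  ∷ D) =
  ℕ.≤-trans (weight-rank S D) (ℕ.+-monoʳ-≤ ∣ S ∣ (ℕ.n≤1+n _))
weight-rank (inside  ∷ S) (outside ∷ D) = s≤s (weight-rank S D)
weight-rank (inside  ∷ S) (inside  ∷ D) =
  s≤s (ℕ.≤-trans (s≤s (weight-rank S D)) (ℕ.≤-reflexive (sym (ℕ.+-suc ∣ S ∣ ∣ D ∣))))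

-- Neighbours, connectedness and the domination parameters

module _ {n} {G : Graph n} where

  Adj⇒≢ : ∀ {u v} → Adj G u v → u ≢ v
  Adj⇒≢ {u} uv refl = adj-irrefl G u uv

  mapTwoNeighbours : ∀ {P Q : Fin n → Set} → (∀ {u} → P u → Q u) → ∀ {v} →
                     HasTwoNeighbours G P v → HasTwoNeighbours G Q v
  mapTwoNeighbours P⇒Q (a , b , a≢b , (va , pa) , (vb , pb)) =
    a , b , a≢b , (va , P⇒Q pa) , (vb , P⇒Q pb)

  -- Two distinct neighbours cannot both be `s`. This is what lets 2-domination survive, as
  -- domination, the deletion of one vertex.
  avoid : ∀ {P v} s → HasTwoNeighbours G P v → HasNeighbour G (λ u → P u × u ≢ s) v
  avoid s (a , b , a≢b , (va , pa) , (vb , pb)) with a ≟ s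
  ... | yes refl = b , vb , pb , a≢b ∘ sym
  ... | no  a≢s  = a , va , pa , a≢s

  closed⇒everything : Connected G → {P : Fin n → Set} →
                      (∀ {u v} → Adj G u v → P u → P v) → ∀ {u} → P u → ∀ v → P v
  closed⇒everything (_ , conn) {P} step pu v = go (conn _ v) pu
    where
    go : ∀ {u} → Star (Adj G) u v → P u → P v
    go ε         pu = pu
    go (e ◅ walk) pu = go walk (step e pu)

  rd⇒dominating : ∀ {S} → RestrainedDominating G S → Dominating G S
  rd⇒dominating rd v = proj₁ ∘ rd v

  r2d⇒rd : ∀ {S} → Restrained2Dominating G S → RestrainedDominating G S
  r2d⇒rd (two , non-isolated) v v∉S with a , _ , _ , va , _ ← two v v∉S =
    (a , va) , non-isolated v v∉S

  γ≤ : ∀ {S} → Dominating G S → γ G ≤ ∣ S ∣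
  γ≤ = proj₂ (proj₂ (γ-minimum G)) _

  γr≤ : ∀ {S} → RestrainedDominating G S → γr G ≤ ∣ S ∣
  γr≤ = proj₂ (proj₂ (γr-minimum G)) _

  γr2≤ : ∀ {S} → Restrained2Dominating G S → γr2 G ≤ ∣ S ∣
  γr2≤ = proj₂ (proj₂ (γr2-minimum G)) _

  γ≤γr : γ G ≤ γr G
  γ≤γr with (S , rd , ∣S∣≡) , _ ← proj₂ (γr-minimum G) =
    subst (γ G ≤_) ∣S∣≡ (γ≤ (rd⇒dominating rd))

  γr≤γr2 : γr G ≤ γr2 G
  γr≤γr2 with (S , r2d , ∣S∣≡) , _ ← proj₂ (γr2-minimum G) =
    subst (γr G ≤_) ∣S∣≡ (γr≤ (r2d⇒rd r2d))

  -- The RDRD function is 2 on D, 1 on S ∖ D, and 0 off S.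
  γrdR≤ : ∀ {S D} → D ⊆ S →
          (∀ v → v ∉ S → HasTwoNeighbours G (_∈ D) v) →
          (∀ v → v ∉ D → v ∈ S → HasNeighbour G (_∈ D) v) →
          NoIsolatedIn G (_∉ S) →
          γrdR G ≤ ∣ S ∣ + ∣ D ∣
  γrdR≤ {S} {D} D⊆S two one non-isolated =
    ℕ.≤-trans (proj₂ (proj₂ (γrdR-minimum G)) f rdrd) (weight-rank S D)
    where
    f = zipWith rank S D

    value : ∀ {v b c} → lookup S v ≡ b → lookup D v ≡ c → lookup f v ≡ rank b c
    value {v} p q = trans (lookup-zipWith rank v S D) (cong₂ rank p q)

    ∉⇒lookup : ∀ {p : Subset n} {v} → v ∉ p → lookup p v ≡ outside
    ∉⇒lookup {p} {v} v∉p = ¬-not (v∉p ∘ lookup⇒[]= v p)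

    value-∈ : ∀ {v} → v ∈ D → lookup f v ≡ 2F
    value-∈ v∈D = value ([]=⇒lookup (D⊆S v∈D)) ([]=⇒lookup v∈D)

    value-∉ : ∀ {v} → v ∉ S → lookup f v ≡ 0F
    value-∉ v∉S = value (∉⇒lookup v∉S) refl

    value≡0⇒∉ : ∀ {v} → lookup f v ≡ 0F → v ∉ S
    value≡0⇒∉ {v} e v∈S = rank≢0 _ (trans (sym (value ([]=⇒lookup v∈S) refl)) e)
      where
      rank≢0 : ∀ c → rank inside c ≢ 0F
      rank≢0 outside ()
      rank≢0 inside  ()

    value≡1⇒∈ : ∀ {v} → lookup f v ≡ 1F → v ∈ S
    value≡1⇒∈ {v} e = decidable-stable (v ∈? S) λ v∉S →
      contradiction (trans (sym (value-∉ v∉S)) e) λ ()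

    value≡1⇒∉ : ∀ {v} → lookup f v ≡ 1F → v ∉ D
    value≡1⇒∉ e v∈D = contradiction (trans (sym (value-∈ v∈D)) e) λ ()

    rdrd : RDRD G f
    rdrd =
      (λ v e → inj₁ (mapTwoNeighbours value-∈ (two v (value≡0⇒∉ e)))) ,
      (λ v e → let u , vu , u∈D = one v (value≡1⇒∉ e) (value≡1⇒∈ e)
               in u , vu , inj₁ (value-∈ u∈D)) ,
      (λ v e → let u , vu , u∉S = non-isolated v (value≡0⇒∉ e)
               in u , vu , value-∉ u∉S)

-- Stars

  -- A star described by its centre inside `G`, without an isomorphism. The one-vertex graph
  -- qualifies, so a vertex other than `c` is supplied separately wherever `m ≥ 1` is at stake.
  StarAt : Fin n → Set
  StarAt c = (∀ {u} → u ≢ c → Adj G c u) × (∀ {u v} → u ≢ c → v ≢ c → ¬ Adj G u v)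

  -- Adjacency of `u` and `v` is not part of this; along an edge it says that `u` has degree one.
  Leaf : Fin n → Fin n → Set
  Leaf u v = ∀ w → Adj G u w → w ≡ v

  starAt-edge : ∀ {c u v} → StarAt c → Adj G u v → u ≡ c ⊎ v ≡ c
  starAt-edge {c} {u} {v} (_ , leaves) uv with u ≟ c
  ... | yes u≡c = inj₁ u≡c
  ... | no  u≢c = inj₂ (decidable-stable (v ≟ c) λ v≢c → leaves u≢c v≢c uv)

  -- The closed neighbourhood of `c` is closed under adjacency, hence is the whole vertex set by
  -- connectedness.
  leaves⇒starAt : Connected G → ∀ {c} → (∀ {u} → Adj G c u → Leaf u c) → StarAt c
  leaves⇒starAt conn {c} leaf =
    (λ u≢c → [ (λ u≡c → contradiction u≡c u≢c) , (λ cu → cu) ]′ (near _)) ,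
    (λ u≢c v≢c uv → [ u≢c , (λ cu → v≢c (leaf cu _ uv)) ]′ (near _))
    where
    step : ∀ {u v} → Adj G u v → u ≡ c ⊎ Adj G c u → v ≡ c ⊎ Adj G c v
    step uv (inj₁ refl) = inj₂ uv
    step uv (inj₂ cu)   = inj₁ (leaf cu _ uv)

    near : ∀ v → v ≡ c ⊎ Adj G c v
    near = closed⇒everything conn step (inj₁ refl)

  -- The centre is the end of the given edge opposite to an end of degree one.
  pendantEdges⇒starAt : Connected G → (∀ {u v} → Adj G u v → Leaf u v ⊎ Leaf v u) →
                        ∀ {u v} → Adj G u v → ∃ StarAt
  pendantEdges⇒starAt conn pendant {u} {v} uv =
    [ (λ leaf-u → v , leaves⇒starAt conn (leaves (adj-sym G uv) leaf-u))
    , (λ leaf-v → u , leaves⇒starAt conn (leaves uv leaf-v)) ]′ (pendant uv)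
    where
    leaves : ∀ {c x} → Adj G c x → Leaf x c → ∀ {w} → Adj G c w → Leaf w c
    leaves cx leaf-x cw with pendant cw
    ... | inj₂ leaf-w = leaf-w
    -- If `c` is the end of degree one, its only neighbour `w` is the vertex `x` already known to be
    -- a leaf.
    ... | inj₁ leaf-c with refl ← leaf-c _ cx = leaf-x

  -- A vertex outside `S` has a neighbour in `S` and another outside `S`, which is impossible for a
  -- vertex whose only neighbour is the centre.
  starAt-rd-full : ∀ {c S} → StarAt c → RestrainedDominating G S → ∀ v → v ∈ S
  starAt-rd-full {c} {S} star rd v = decidable-stable (v ∈? S) absurd
    where
    leaf : ∀ {u w} → u ≢ c → Adj G u w → w ≡ c
    leaf u≢c uw = [ (λ u≡c → contradiction u≡c u≢c) , (λ w≡c → w≡c) ]′ (starAt-edge star uw)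

    absurd : ¬ v ∉ S
    absurd v∉S with rd v v∉S | v ≟ c
    ... | (a , va , a∈S) , (b , vb , b∉S) | no v≢c =
      b∉S (subst (_∈ S) (trans (leaf v≢c va) (sym (leaf v≢c vb))) a∈S)
    -- If the centre is outside `S`, so is some leaf `b`, and its neighbour in `S` could only be the
    -- centre.
    ... | _ , (b , vb , b∉S) | yes refl with (d , bd , d∈S) , _ ← rd b b∉S =
      v∉S (subst (_∈ S) (leaf (Adj⇒≢ vb ∘ sym) bd) d∈S)

-- Minimum restrained dominating sets

  module _ {S} (r2d : Restrained2Dominating G S)
           (min : ∀ S′ → RestrainedDominating G S′ → ∣ S ∣ ≤ ∣ S′ ∣) where

    -- Otherwise `S - s` is a smaller restrained dominating set: `s` has `a` inside and `x` outside,
    -- and every other outside vertex loses at most one of its two neighbours in `S`.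
    closed-outward : ∀ {s a x} → s ∈ S → Adj G s a → a ∈ S → Adj G s x → x ∈ S
    closed-outward {s} {a} {x} s∈S sa a∈S sx = decidable-stable (x ∈? S) λ x∉S →
      ℕ.<⇒≱ (x∈p⇒∣p-x∣<∣p∣ s∈S) (min (S - s) (rd x∉S))
      where
      rd : x ∉ S → RestrainedDominating G (S - s)
      rd x∉S v v∉ with x∉p-y⇒x≡y⊎x∉p v∉
      ... | inj₁ refl = (a , sa , x∈p∧x≢y⇒x∈p-y a∈S (Adj⇒≢ sa ∘ sym)) ,
                        (x , sx , x∉p⇒x∉p-y s x∉S)
      ... | inj₂ v∉S with a , va , a∈S , a≢s ← avoid s (proj₁ r2d v v∉S)
                       | b , vb , b∉S ← proj₂ r2d v v∉S =
        (a , va , x∈p∧x≢y⇒x∈p-y a∈S a≢s) , (b , vb , x∉p⇒x∉p-y s b∉S)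

    minimum-full : Connected G → ∀ {s a} → s ∈ S → Adj G s a → a ∈ S → ∀ v → v ∈ S
    minimum-full conn {a = a} s∈S sa a∈S v =
      proj₁ (closed⇒everything conn step (s∈S , a , sa , a∈S) v)
      where
      -- Membership in `S` alone would not propagate, since `closed-outward` needs a neighbour in
      -- `S` as well; for `v` the preceding vertex `u` serves.
      step : ∀ {u v} → Adj G u v →
             u ∈ S × HasNeighbour G (_∈ S) u → v ∈ S × HasNeighbour G (_∈ S) v
      step uv (u∈S , b , ub , b∈S) = closed-outward u∈S ub b∈S uv , _ , adj-sym G uv , u∈S

  leaf? : ∀ u v → Leaf u v ⊎ ∃ λ w → Adj G u w × w ≢ v
  leaf? u v with any? (λ w → adj? G u w ×-dec ¬? (w ≟ v))
  ... | yes p = inj₂ p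
  ... | no ¬p = inj₁ λ w uw → decidable-stable (w ≟ v) λ w≢v → ¬p (w , uw , w≢v)

  -- If neither end is a leaf, deleting both from `⊤` leaves a restrained dominating set: each end
  -- has the other one outside and a further neighbour inside.
  full⇒pendantEdges : (∀ S → RestrainedDominating G S → n ≤ ∣ S ∣) →
                      ∀ {u v} → Adj G u v → Leaf u v ⊎ Leaf v u
  full⇒pendantEdges min {s} {t} st with leaf? s t | leaf? t s
  ... | inj₁ leaf-s | _           = inj₁ leaf-s
  ... | inj₂ _      | inj₁ leaf-t = inj₂ leaf-t
  ... | inj₂ (a , sa , a≢t) | inj₂ (b , tb , b≢s) =
    contradiction (min (⊤ - s - t) rd)
      (ℕ.<⇒≱ (ℕ.<-≤-trans (x∈p⇒∣p-x∣<∣p∣ t∈) (∣p∣≤n (⊤ - s))))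
    where
    t∈ : t ∈ ⊤ - s
    t∈ = x∈p∧x≢y⇒x∈p-y ∈⊤ (Adj⇒≢ st ∘ sym)

    ∈⊤-s-t : ∀ {x} → x ≢ s → x ≢ t → x ∈ ⊤ - s - t
    ∈⊤-s-t x≢s x≢t = x∈p∧x≢y⇒x∈p-y (x∈p∧x≢y⇒x∈p-y ∈⊤ x≢s) x≢t

    rd : RestrainedDominating G (⊤ - s - t)
    rd v v∉ with x∉p-y⇒x≡y⊎x∉p v∉
    ... | inj₁ refl = (b , tb , ∈⊤-s-t b≢s (Adj⇒≢ tb ∘ sym)) ,
                      (s , adj-sym G st , x∉p⇒x∉p-y t (x∉p-x ⊤ s))
    ... | inj₂ v∉′ with x∉p-y⇒x≡y⊎x∉p v∉′
    ...   | inj₁ refl = (a , sa , ∈⊤-s-t (Adj⇒≢ sa ∘ sym) a≢t) , (t , st , x∉p-x (⊤ - s) t)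
    ...   | inj₂ v∉⊤  = contradiction ∈⊤ v∉⊤

  minimum⇒starAt : Connected G → ∀ {S} → Restrained2Dominating G S → ∣ S ∣ ≡ γr G →
                   ∀ {s a} → s ∈ S → Adj G s a → a ∈ S → ∃ StarAt
  minimum⇒starAt conn {S} r2d ∣S∣≡ s∈S sa a∈S =
    pendantEdges⇒starAt conn (full⇒pendantEdges λ S′ rd → ℕ.≤-trans n≤∣S∣ (min S′ rd)) sa
    where
    min : ∀ S′ → RestrainedDominating G S′ → ∣ S ∣ ≤ ∣ S′ ∣
    min S′ rd = subst (_≤ ∣ S′ ∣) (sym ∣S∣≡) (γr≤ rd)

    n≤∣S∣ : n ≤ ∣ S ∣
    n≤∣S∣ = subst (_≤ ∣ S ∣) (∣⊤∣≡n n)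
      (p⊆q⇒∣p∣≤∣q∣ {p = ⊤} λ {v} _ → minimum-full r2d min conn s∈S sa a∈S v)

-- The bounds and their equality cases

  module RDRDSets {f} (rdrd : RDRD G f) where

    S = level 1 f
    D = level 2 f

    D⊆S : D ⊆ S
    D⊆S = ∈-level⁺ ∘ ℕ.<⇒≤ ∘ ∈-level⁻ {k = 2}

    value≡2⇒∈D : ∀ {v} → lookup f v ≡ 2F → v ∈ D
    value≡2⇒∈D e = ∈-level⁺ (ℕ.≤-reflexive (sym (cong toℕ e)))

    value≡3⇒∈V₃ : ∀ {v} → lookup f v ≡ 3F → v ∈ level 3 f
    value≡3⇒∈V₃ e = ∈-level⁺ (ℕ.≤-reflexive (sym (cong toℕ e)))

    value≡3⇒∈D : ∀ {v} → lookup f v ≡ 3F → v ∈ D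
    value≡3⇒∈D = ∈-level⁺ ∘ ℕ.<⇒≤ ∘ ∈-level⁻ {k = 3} ∘ value≡3⇒∈V₃

    ∉S⇒value≡0 : ∀ {v} → v ∉ S → lookup f v ≡ 0F
    ∉S⇒value≡0 {v} v∉S with lookup f v in e
    ... | zero  = refl
    ... | suc x = contradiction (∈-level⁺ (subst ((1 ≤_) ∘ toℕ) (sym e) (s≤s z≤n))) v∉S

    value≡0⇒∉S : ∀ {v} → lookup f v ≡ 0F → v ∉ S
    value≡0⇒∉S e v∈S = contradiction (subst ((1 ≤_) ∘ toℕ) e (∈-level⁻ v∈S)) λ ()

    non-isolated : NoIsolatedIn G (_∉ S)
    non-isolated v v∉S with u , vu , e ← proj₂ (proj₂ rdrd) v (∉S⇒value≡0 v∉S) =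
      u , vu , value≡0⇒∉S e

    -- The conditions on the values 0 and 1 both yield a neighbour of value at least 2.
    dominating : Dominating G D
    dominating v v∉D with lookup f v in e
    ... | 0F with proj₁ rdrd v e
    ...   | inj₁ (u , _ , _ , (vu , e₂) , _) = u , vu , value≡2⇒∈D e₂
    ...   | inj₂ (u , vu , e₃)               = u , vu , value≡3⇒∈D e₃
    dominating v v∉D | 1F with u , vu , e₂₃ ← proj₁ (proj₂ rdrd) v e =
      u , vu , [ value≡2⇒∈D , value≡3⇒∈D ]′ e₂₃
    dominating v v∉D | 2F = contradiction (value≡2⇒∈D e) v∉D
    dominating v v∉D | 3F = contradiction (value≡3⇒∈D e) v∉D

    restrained : RestrainedDominating G S
    restrained v v∉S with u , vu , u∈D ← dominating v (v∉S ∘ D⊆S) =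
      (u , vu , D⊆S u∈D) , non-isolated v v∉S

    γ+γr≤∣S∣+∣D∣ : γ G + γr G ≤ ∣ S ∣ + ∣ D ∣
    γ+γr≤∣S∣+∣D∣ = ℕ.≤-trans (ℕ.≤-reflexive (ℕ.+-comm (γ G) (γr G)))
      (ℕ.+-mono-≤ (γr≤ restrained) (γ≤ dominating))

    γ+γr≤weight : γ G + γr G ≤ weight f
    γ+γr≤weight = ℕ.≤-trans γ+γr≤∣S∣+∣D∣
      (ℕ.≤-trans (ℕ.m≤m+n _ _) (ℕ.≤-reflexive (sym (weight-level f))))

    module _ (tight : weight f ≡ γ G + γr G) where

      ∣S∣+∣D∣+∣V₃∣≡ : ∣ S ∣ + ∣ D ∣ + ∣ level 3 f ∣ ≡ γ G + γr G
      ∣S∣+∣D∣+∣V₃∣≡ = trans (sym (weight-level f)) tight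

      ∣S∣+∣D∣≤ : ∣ S ∣ + ∣ D ∣ ≤ γ G + γr G
      ∣S∣+∣D∣≤ = subst (∣ S ∣ + ∣ D ∣ ≤_) ∣S∣+∣D∣+∣V₃∣≡ (ℕ.m≤m+n _ _)

      -- The sets `S` and `D` alone already use up `γ G + γr G`, so nothing of the weight is left
      -- for the third level.
      ∣V₃∣≤0 : ∣ level 3 f ∣ ≤ 0
      ∣V₃∣≤0 = ℕ.+-cancelˡ-≤ (∣ S ∣ + ∣ D ∣) _ _ (begin
        ∣ S ∣ + ∣ D ∣ + ∣ level 3 f ∣  ≡⟨ ∣S∣+∣D∣+∣V₃∣≡ ⟩
        γ G + γr G                     ≤⟨ γ+γr≤∣S∣+∣D∣ ⟩
        ∣ S ∣ + ∣ D ∣                  ≡⟨ ℕ.+-identityʳ _ ⟨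
        ∣ S ∣ + ∣ D ∣ + 0              ∎)
        where open ℕ.≤-Reasoning

      ∣S∣≡γr : ∣ S ∣ ≡ γr G
      ∣S∣≡γr = ℕ.≤-antisym (ℕ.+-cancelʳ-≤ (γ G) _ _ (begin
        ∣ S ∣ + γ G    ≤⟨ ℕ.+-monoʳ-≤ ∣ S ∣ (γ≤ dominating) ⟩
        ∣ S ∣ + ∣ D ∣  ≤⟨ ∣S∣+∣D∣≤ ⟩
        γ G + γr G     ≡⟨ ℕ.+-comm (γ G) (γr G) ⟩
        γr G + γ G     ∎)) (γr≤ restrained)
        where open ℕ.≤-Reasoning

      ∣D∣≤γ : ∣ D ∣ ≤ γ G
      ∣D∣≤γ = ℕ.+-cancelˡ-≤ (γr G) _ _ (begin
        γr G + ∣ D ∣   ≡⟨ cong (_+ ∣ D ∣) ∣S∣≡γr ⟨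
        ∣ S ∣ + ∣ D ∣  ≤⟨ ∣S∣+∣D∣≤ ⟩
        γ G + γr G     ≡⟨ ℕ.+-comm (γ G) (γr G) ⟩
        γr G + γ G     ∎)
        where open ℕ.≤-Reasoning

      restrained2 : Restrained2Dominating G S
      restrained2 = two , non-isolated
        where
        two : ∀ v → v ∉ S → HasTwoNeighbours G (_∈ S) v
        two v v∉S with proj₁ rdrd v (∉S⇒value≡0 v∉S)
        ... | inj₁ two₂ = mapTwoNeighbours (D⊆S ∘ value≡2⇒∈D) two₂
        -- A neighbour of value 3 is excluded because the third level is empty.
        ... | inj₂ (u , _ , e₃) =
          contradiction (ℕ.≤-trans (x∈p⇒1≤∣p∣ (value≡3⇒∈V₃ e₃)) ∣V₃∣≤0) λ ()

      starAt⊎γ : Connected G →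
                 (∃ λ c → StarAt c × ∃ λ u → u ≢ c) ⊎ (γr2 G ≡ γr G × γr G ≡ γ G)
      starAt⊎γ conn with any? (λ v → (v ∈? S) ×-dec ¬? (v ∈? D))
      -- Domination by `D` gives `v` a neighbour in `D ⊆ S`, which is the edge inside `S` that
      -- forces a star.
      ... | yes (v , v∈S , v∉D) with u , vu , u∈D ← dominating v v∉D
                                with minimum⇒starAt conn restrained2 ∣S∣≡γr v∈S vu (D⊆S u∈D)
      -- At least one end of the edge `v u` differs from the centre, which rules out the one-vertex
      -- graph.
      ... | c , star with v ≟ c
      ...   | no  v≢c  = inj₁ (c , star , v , v≢c)
      ...   | yes refl = inj₁ (c , star , u , Adj⇒≢ vu ∘ sym)
      starAt⊎γ conn | no S⊈D = inj₂
        ( ℕ.≤-antisym (subst (γr2 G ≤_) ∣S∣≡γr (γr2≤ restrained2)) γr≤γr2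
        , ℕ.≤-antisym (begin
            γr G   ≡⟨ ∣S∣≡γr ⟨
            ∣ S ∣  ≤⟨ p⊆q⇒∣p∣≤∣q∣ {p = S} {D} S⊆D ⟩
            ∣ D ∣  ≤⟨ ∣D∣≤γ ⟩
            γ G    ∎) γ≤γr )
        where
        open ℕ.≤-Reasoning

        S⊆D : S ⊆ D
        S⊆D {v} v∈S = decidable-stable (v ∈? D) λ v∉D → S⊈D (v , v∈S , v∉D)

  γ+γr≤γrdR : γ G + γr G ≤ γrdR G
  γ+γr≤γrdR with (f , rdrd , w≡) , _ ← proj₂ (γrdR-minimum G) =
    subst (γ G + γr G ≤_) w≡ (RDRDSets.γ+γr≤weight {f} rdrd)

  tight⇒starAt⊎γ : Connected G → γrdR G ≡ γ G + γr G →
                   (∃ λ c → StarAt c × ∃ λ u → u ≢ c) ⊎ (γr2 G ≡ γr G × γr G ≡ γ G)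
  tight⇒starAt⊎γ conn tight with (f , rdrd , w≡) , _ ← proj₂ (γrdR-minimum G) =
    RDRDSets.starAt⊎γ {f} rdrd (trans w≡ tight) conn

  -- Value 2 at the centre and 1 at the leaves costs `n + 1`. Domination needs at least one vertex,
  -- and restrained domination of a star needs all `n`.
  starAt⇒γrdR≤ : ∀ {c} → StarAt c → γrdR G ≤ γ G + γr G
  starAt⇒γrdR≤ {c} star = begin
    γrdR G                 ≤⟨ γrdR≤ {⊤} {⁅ c ⁆} (λ _ → ∈⊤) (λ _ v∉ → contradiction ∈⊤ v∉)
                                one (λ _ v∉ → contradiction ∈⊤ v∉) ⟩
    ∣ ⊤ {n} ∣ + ∣ ⁅ c ⁆ ∣  ≡⟨ cong₂ _+_ (∣⊤∣≡n n) (∣⁅x⁆∣≡1 c) ⟩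
    n + 1                  ≡⟨ ℕ.+-comm n 1 ⟩
    1 + n                  ≤⟨ ℕ.+-mono-≤ 1≤γ n≤γr ⟩
    γ G + γr G             ∎
    where
    open ℕ.≤-Reasoning

    one : ∀ v → v ∉ ⁅ c ⁆ → v ∈ ⊤ → HasNeighbour G (_∈ ⁅ c ⁆) v
    one v v∉ _ = c , adj-sym G (proj₁ star λ { refl → v∉ (x∈⁅x⁆ c) }) , x∈⁅x⁆ c

    1≤γ : 1 ≤ γ G
    1≤γ with (D , dom , ∣D∣≡) , _ ← proj₂ (γ-minimum G) with c ∈? D
    ... | yes c∈D = subst (1 ≤_) ∣D∣≡ (x∈p⇒1≤∣p∣ c∈D)
    ... | no  c∉D = subst (1 ≤_) ∣D∣≡ (x∈p⇒1≤∣p∣ (proj₂ (proj₂ (dom c c∉D))))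

    n≤γr : n ≤ γr G
    n≤γr with (S , rd , ∣S∣≡) , _ ← proj₂ (γr-minimum G) =
      subst₂ _≤_ (∣⊤∣≡n n) ∣S∣≡ (p⊆q⇒∣p∣≤∣q∣ {p = ⊤} λ {v} _ → starAt-rd-full star rd v)

  -- A minimum restrained 2-dominating set plays the part of both `S` and `D`: value 2 on it and 0
  -- elsewhere.
  γ-equal⇒γrdR≤ : γr2 G ≡ γr G → γr G ≡ γ G → γrdR G ≤ γ G + γr G
  γ-equal⇒γrdR≤ γr2≡γr γr≡γ with (S , (two , non-isolated) , ∣S∣≡) , _ ← proj₂ (γr2-minimum G) =
    begin
    γrdR G         ≤⟨ γrdR≤ (λ v∈S → v∈S) two (λ _ v∉S v∈S → contradiction v∈S v∉S) non-isolated ⟩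
    ∣ S ∣ + ∣ S ∣  ≡⟨ cong₂ _+_ (trans ∣S∣≡ (trans γr2≡γr γr≡γ)) (trans ∣S∣≡ γr2≡γr) ⟩
    γ G + γr G     ∎
    where open ℕ.≤-Reasoning

-- Stars with a marked centre and the graphs `K₁, m`

K₁-edge : ∀ {m u v} → Adj (K₁, m) u v → (u ≡ 0F × v ≢ 0F) ⊎ (u ≢ 0F × v ≡ 0F)
K₁-edge {u = zero}  {suc _} _ = inj₁ (refl , λ ())
K₁-edge {u = suc _} {zero}  _ = inj₂ ((λ ()) , refl)

K₁-centre : ∀ {m} {u : Fin (suc m)} → u ≢ 0F → Adj (K₁, m) 0F u
K₁-centre {u = zero}  u≢0 = contradiction refl u≢0
K₁-centre {u = suc _} _   = _

isStar⇒starAt : ∀ {n} {G : Graph n} → IsStar G → ∃ (StarAt {G = G})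
isStar⇒starAt {G = G} (m , _ , φ , adj⇔) = c , centre , leaves
  where
  open Inverse φ
  c = from 0F

  to-≢0 : ∀ {u} → u ≢ c → to u ≢ 0F
  to-≢0 {u} u≢c e = u≢c (trans (sym (strictlyInverseʳ u)) (cong from e))

  centre : ∀ {u} → u ≢ c → Adj G c u
  centre {u} u≢c = Equivalence.from (adj⇔ c u)
    (subst (λ x → Adj (K₁, m) x (to u)) (sym (strictlyInverseˡ 0F)) (K₁-centre (to-≢0 u≢c)))

  leaves : ∀ {u v} → u ≢ c → v ≢ c → ¬ Adj G u v
  leaves {u} {v} u≢c v≢c uv =
    [ to-≢0 u≢c ∘ proj₁ , to-≢0 v≢c ∘ proj₂ ]′
      (K₁-edge {u = to u} {to v} (Equivalence.to (adj⇔ u v) uv))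

-- The vertex `u` excludes `n = 1`, so at least one leaf exists.
starAt⇒isStar : ∀ {n} {G : Graph n} {c u} → StarAt {G = G} c → u ≢ c → IsStar G
starAt⇒isStar {suc zero}    {c = zero} {zero} _ u≢c = contradiction refl u≢c
starAt⇒isStar {suc (suc m)} {G} {c} star@(centre , _) _ =
  suc m , s≤s z≤n , φ , λ u v → mk⇔ adj⇒ adj⇐
  where
  -- All that matters about the permutation is that it sends `c` to `0F`, since the centre
  -- determines every adjacency of a star.
  φ = Perm.transpose c 0F
  open Inverse φ

  to-c : to c ≡ 0F
  to-c with c ≟ c
  ... | yes _   = refl
  ... | no  c≢c = contradiction refl c≢c

  to-≢0 : ∀ {u} → u ≢ c → to u ≢ 0F
  to-≢0 {u} u≢c e = u≢c (trans (sym (strictlyInverseʳ u))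
    (trans (cong from (trans e (sym to-c))) (strictlyInverseʳ c)))

  to-≡0 : ∀ {u} → to u ≡ 0F → u ≡ c
  to-≡0 {u} e = decidable-stable (u ≟ c) λ u≢c → to-≢0 u≢c e

  to-≡c : ∀ {u} → to u ≢ 0F → u ≢ c
  to-≡c e refl = e to-c

  from-c : ∀ {u} → Adj G c u → Adj (K₁, suc m) (to c) (to u)
  from-c {u} cu = subst (λ x → Adj (K₁, suc m) x (to u)) (sym to-c)
    (K₁-centre (to-≢0 (Adj⇒≢ {G = G} cu ∘ sym)))

  adj⇒ : ∀ {u v} → Adj G u v → Adj (K₁, suc m) (to u) (to v)
  adj⇒ {u} uv with starAt-edge {G = G} star uv
  ... | inj₁ refl = from-c uv
  ... | inj₂ refl = adj-sym (K₁, suc m) {to c} {to u} (from-c (adj-sym G uv))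

  adj⇐ : ∀ {u v} → Adj (K₁, suc m) (to u) (to v) → Adj G u v
  adj⇐ {u} {v} e with K₁-edge {u = to u} {to v} e
  ... | inj₁ (eu , ev) with refl ← to-≡0 {u} eu = centre (to-≡c ev)
  ... | inj₂ (eu , ev) with refl ← to-≡0 {v} ev = adj-sym G (centre (to-≡c eu))

theorem2p8 : ∀ (n : ℕ) (G : Graph n) → Connected G →
    (γrdR G ≥ γ G + γr G) ×
    ((γrdR G ≡ γ G + γr G) ⇔ (IsStar G ⊎ (γr2 G ≡ γr G × γr G ≡ γ G)))
theorem2p8 n G conn =
  lower , mk⇔ tight⇒ λ alt → ℕ.≤-antisym (upper alt) lower
  where
  lower = γ+γr≤γrdR {G = G}

  tight⇒ : γrdR G ≡ γ G + γr G → IsStar G ⊎ (γr2 G ≡ γr G × γr G ≡ γ G)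
  tight⇒ tight with tight⇒starAt⊎γ {G = G} conn tight
  ... | inj₁ (c , star , u , u≢c) = inj₁ (starAt⇒isStar {G = G} star u≢c)
  ... | inj₂ equal                = inj₂ equal

  upper : IsStar G ⊎ (γr2 G ≡ γr G × γr G ≡ γ G) → γrdR G ≤ γ G + γr G
  upper (inj₁ star)             = starAt⇒γrdR≤ {G = G} (proj₂ (isStar⇒starAt {G = G} star))
  upper (inj₂ (γr2≡γr , γr≡γ))= γ-equal⇒γrdR≤ {G = G} γr2≡γr γr≡γ
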